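{- Let $\mathscr{A}=(G,\partial)$ be a unicyclization of a connected graph $G$, let $\beta$ be a fixed basis of $Z_1(G)=\ker\partial_1$, let $w_{\mathscr{A}}(z)=\det([z]_\beta,[\partial]_\beta)$ be the winding number map relative to $\beta$, and let $$\lambda_{\mathscr{A}}=\sum_{Y\in\mathcal{U}(G)}w_{\mathscr{A}}(z_Y)\cdot z_Y .$$ Then for every $C\in\ker\partial_1$, $$C\circ\lambda_{\mathscr{A}}=w_{\mathscr{A}}(C)\cdot k(G),$$ where $k(G)$ is the number of spanning trees of $G$.
   Context: Graphs are finite and connected; loops and multiple edges are allowed. Fix an orientation of each edge. $C_1(G)=\mathbb{Z}^{E(G)}$, $C_0(G)=\mathbb{Z}^{V(G)}$, and $\partial_1:C_1(G)\to C_0(G)$ is the (oriented) incidence matrix (a loop gives a zero column). $Z_1(G)=\ker\partial_1$ is a free abelian group of rank $m=|E(G)|-|V(G)|+1$. The symbol $\circ$ is the standard inner product on $C_1(G)$ for which the edges are orthonormal. A unicyclizer of $G$ is an integer matrix $\partial$ (rows indexed by $E(G)$) with (1) $\ker\partial=0$, (2) $\partial_1\partial=0$, (3) $\operatorname{rk}(\ker\partial_1/\operatorname{im}\partial)=1$. So $\partial$ has $m-1$ linearly independent columns, all in $Z_1(G)$ (when $m=1$ it has no columns). The pair $\mathscr{A}=(G,\partial)$ is called a unicyclization of $G$. For a basis $\beta$ of $Z_1(G)$, $[z]_\beta\in\mathbb{Z}^m$ is the coordinate column vector of $z\in Z_1(G)$, $[\partial]_\beta$ is the $m\times(m-1)$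 matrix whose columns are the coordinate vectors of the columns of $\partial$, and $([z]_\beta,[\partial]_\beta)$ is the $m\times m$ matrix with first column $[z]_\beta$. A cycletree of $G$ is a connected spanning subgraph $Y$ of $G$ containing exactly one cycle $C_Y$ (a loop, or a pair of parallel edges, may be that cycle). $\mathcal{U}(G)$ is the set of cycletrees of $G$. $z_Y\in Z_1(G)$ is the $\{0,\pm1\}$-vector of $C_Y$ with either orientation chosen; the product $w_{\mathscr{A}}(z_Y)\cdot z_Y$ does not depend on this choice. -}

module Defs where

import Algebra.Properties.Semiring.Sum as Sum
open import Data.Bool.Base using (if_then_else_)
import Data.Bool.Properties as Bool
open import Data.Fin.Base using (Fin; zero; suc; toℕ; punchIn)
import Data.Fin.Properties as Fin
open import Data.Fin.Subset using (Subset; inside; outside; _∈_; _⊆_; ⁅_⁆; ⋃)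
open import Data.Fin.Subset.Properties using (_∈?_; _⊆?_; anySubset?)
open import Data.Integer.Base using (ℤ; 0ℤ; 1ℤ; -1ℤ; _+_; _*_; _-_; _^_; _◃_)
import Data.Integer.Properties as ℤ
open import Data.Integer.Tactic.RingSolver using (solve-∀)
open import Data.List.Base as List using (List; []; _∷_; _++_; map; length; filter; mapMaybe; foldr)
import Data.List.Membership.DecPropositional as DecMembership
open import Data.List.Membership.Propositional using () renaming (_∈_ to _∈ₗ_)
open import Data.List.Membership.Propositional.Properties using (∈-lookup)
open import Data.List.Properties using (length-map)
open import Data.List.Relation.Unary.All as All using (All; []; _∷_)
import Data.List.Relation.Unary.All.Properties as All
open import Data.List.Relation.Unary.AllPairs using ([]; _∷_)
open import Data.List.Relation.Unary.Any using (here; there)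
import Data.List.Relation.Unary.Unique.DecPropositional as DecUnique
open import Data.List.Relation.Unary.Unique.Propositional using (Unique)
open import Data.Maybe.Base using () renaming (map to mapᵐ)
open import Data.Nat.Base as ℕ using (ℕ; zero; suc; z≤n; s≤s; NonZero)
import Data.Nat.Properties as ℕ
open import Data.Product using (∃!)
open import Data.Product.Base using (Σ-syntax; ∃; ∃-syntax; _×_; _,_; proj₁; proj₂)
open import Data.Sign.Base as Sign using (Sign)
open import Data.Sum.Base using (inj₁; inj₂)
open import Data.Vec.Base as Vec using ()
open import Data.Vec.Functional using (Vector) renaming (_∷_ to _∷ᶠ_)
import Data.Vec.Properties as Vec
open import Function.Base using (_∘_)
open import Level using (0ℓ)
open import Relation.Binary.PropositionalEquality
open import Relation.Nullary using (¬_; Dec; yes; no; does; contradiction)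
open import Relation.Nullary.Decidable using (map′; _×-dec_; _⊎-dec_; ¬?; dec⇒maybe; decidable-stable)
open import Relation.Unary using (Pred; Decidable)

open Sum ℤ.+-*-semiring public
  using (sum; sum-syntax)
open Sum ℤ.+-*-semiring using (sum-cong-≗; sum-replicate-zero; ∑-distrib-+)
open ≡-Reasoning

Matrix : ℕ → ℕ → Set
Matrix m n = Fin m → Fin n → ℤ

infixr 7 _·_

_·_ : ∀ {m n} → Matrix m n → Vector ℤ n → Vector ℤ m
_·_ {n = n} M x i = ∑[ j < n ] (M i j * x j)

infix 7 _∙_

_∙_ : ∀ {n} → Vector ℤ n → Vector ℤ n → ℤ
_∙_ {n} x y = ∑[ i < n ] (x i * y i)

column : ∀ {m n} → Matrix m n → Fin n → Vector ℤ m
column M j i = M i j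

ofColumns : ∀ {m n} → Vector (Vector ℤ m) n → Matrix m n
ofColumns v i j = v j i

InKernel : ∀ {m n} → Matrix m n → Vector ℤ n → Set
InKernel M x = ∀ i → (M · x) i ≡ 0ℤ

InImage : ∀ {m n} → Matrix m n → Vector ℤ m → Set
InImage M y = ∃[ x ] M · x ≗ y

-- Laplace expansion along the first column.
det : ∀ {n} → Matrix n n → ℤ
det {zero}  M = 1ℤ
det {suc n} M =
  ∑[ i < suc n ] (-1ℤ ^ toℕ i * M i zero * det (λ k l → M (punchIn i k) (suc l)))

-- v is ℤ-linearly independent in the quotient of ℤⁿ by the subgroup B.
IndependentModulo : ∀ {n k} → Pred (Vector ℤ n) 0ℓ → Vector (Vector ℤ n) k → Set
IndependentModulo B v = ∀ c → B (ofColumns v · c) → ∀ i → c i ≡ 0ℤ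

-- The rank of A / B, for subgroups B ⊆ A of ℤⁿ, as the largest number of
-- elements that are ℤ-linearly independent in A / B.
record HasQuotientRank {n} (A B : Pred (Vector ℤ n) 0ℓ) (k : ℕ) : Set where
  field
    attained : Σ[ v ∈ Vector (Vector ℤ n) k ] (∀ i → A (v i)) × IndependentModulo B v
    maximal  : ∀ {l} (v : Vector (Vector ℤ n) l) →
               (∀ i → A (v i)) → IndependentModulo B v → l ℕ.≤ k

-- Loops (src e ≡ tgt e) and parallel edges are allowed; src and tgt are the
-- fixed orientation of the edges.
record Graph : Set where
  field
    nV nE   : ℕ
    src tgt : Fin nE → Fin nV

δ : ∀ {n} → Fin n → Fin n → ℤ
δ i j = if does (i Fin.≟ j) then 1ℤ else 0ℤ

module _ (G : Graph) where
  open Graph G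

  Chain : Set
  Chain = Vector ℤ nE

  ∂₁ : Matrix nV nE
  ∂₁ v e = δ (tgt e) v - δ (src e) v

  Z₁ : Set
  Z₁ = Σ[ x ∈ Chain ] InKernel ∂₁ x

  record IsUnicyclizer {r} (∂ : Matrix nE r) : Set where
    field
      ker-trivial   : ∀ x → InKernel ∂ x → ∀ j → x j ≡ 0ℤ
      ∂₁∂≡0         : ∀ j → InKernel ∂₁ (column ∂ j)
      quotient-rank : HasQuotientRank (InKernel ∂₁) (InImage ∂) 1

    columnZ₁ : Fin r → Z₁
    columnZ₁ j = column ∂ j , ∂₁∂≡0 j

  record Basis (m : ℕ) : Set where
    field
      vectors     : Vector Z₁ m
      independent : IndependentModulo (λ x → ∀ e → x e ≡ 0ℤ) (proj₁ ∘ vectors)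
      spanning    : ∀ (z : Z₁) → ∃[ c ] ofColumns (proj₁ ∘ vectors) · c ≗ proj₁ z

    coordinates : Z₁ → Vector ℤ m
    coordinates z = proj₁ (spanning z)

  -- Since ker ∂₁ / im ∂ has rank 1, every basis of Z₁ has one more element
  -- than ∂ has columns, so ([z]_β , [∂]_β) is square.
  winding : ∀ {r} {∂ : Matrix nE r} → IsUnicyclizer ∂ → Basis (suc r) → Z₁ → ℤ
  winding u β z = det (ofColumns (coordinates z ∷ᶠ coordinates ∘ columnZ₁))
    where
    open IsUnicyclizer u
    open Basis β

  -- An edge together with a direction of traversal (Sign.+ is src to tgt).
  Dart : Set
  Dart = Fin nE × Sign

  edge : Dart → Fin nE
  edge = proj₁

  tail head : Dart → Fin nV
  tail (e , Sign.+) = src e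
  tail (e , Sign.-) = tgt e
  head (e , Sign.+) = tgt e
  head (e , Sign.-) = src e

  IsWalk : Fin nV → List Dart → Fin nV → Set
  IsWalk u []       v = u ≡ v
  IsWalk u (d ∷ ds) v = u ≡ tail d × IsWalk (head d) ds v

  -- A closed walk of positive length without repeated vertices or edges:
  -- length 1 is a loop, length 2 a pair of parallel edges.
  record IsOrientedCycle (ds : List Dart) : Set where
    constructor mkOrientedCycle
    field
      nonEmpty         : ds ≢ []
      closed           : ∃[ v ] IsWalk v ds v
      distinctVertices : Unique (map tail ds)
      distinctEdges    : Unique (map edge ds)

  support : List Dart → Subset nE
  support ds = ⋃ (map (⁅_⁆ ∘ edge) ds)

  Orientation : Subset nE → Set
  Orientation C = Σ[ ds ∈ List Dart ] IsOrientedCycle ds × support ds ≡ C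

  -- A cycle as a subgraph is determined by its edge set.
  IsCycle : Pred (Subset nE) 0ℓ
  IsCycle = Orientation

  walkChain : List Dart → Chain
  walkChain []             e = 0ℤ
  walkChain ((e′ , s) ∷ ds) e = (s ◃ 1) * δ e′ e + walkChain ds e

  -- An edge set Y stands for the spanning subgraph of G with edge set Y;
  -- G itself is the case Y = ⊤. The empty graph is not connected.
  Connected : Pred (Subset nE) 0ℓ
  Connected Y = NonZero nV ×
    (∀ u v → ∃[ ds ] IsWalk u ds v × All (λ d → edge d ∈ Y) ds)

  IsSpanningTree : Pred (Subset nE) 0ℓ
  IsSpanningTree Y = Connected Y × ¬ (∃[ C ] C ⊆ Y × IsCycle C)

  IsCycletree : Pred (Subset nE) 0ℓ
  IsCycletree Y = Connected Y × ∃! _≡_ (λ C → C ⊆ Y × IsCycle C)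

  Cycletree : Set
  Cycletree = ∃ IsCycletree

  cycleOf : Cycletree → Subset nE
  cycleOf (_ , _ , C , _) = C

  private
    anyDart? : ∀ {P : Pred Dart 0ℓ} → Decidable P → Dec (∃ P)
    anyDart? P? = map′
      (λ { (e , inj₁ p) → (e , Sign.+) , p ; (e , inj₂ p) → (e , Sign.-) , p })
      (λ { ((e , Sign.+) , p) → e , inj₁ p ; ((e , Sign.-) , p) → e , inj₂ p })
      (Fin.any? (λ e → P? (e , Sign.+) ⊎-dec P? (e , Sign.-)))

    anyDarts? : ∀ {P : Pred (List Dart) 0ℓ} → Decidable P →
                ∀ n → Dec (∃[ ds ] length ds ℕ.≤ n × P ds)
    anyDarts? P? zero = map′
      (λ p → [] , z≤n , p) (λ { ([] , _ , p) → p }) (P? [])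
    anyDarts? P? (suc n) = map′
      (λ { (inj₁ p)                → [] , z≤n , p
         ; (inj₂ (d , ds , l , p)) → d ∷ ds , s≤s l , p })
      (λ { ([] , _ , p)           → inj₁ p
         ; (d ∷ ds , s≤s l , p)   → inj₂ (d , ds , l , p) })
      (P? [] ⊎-dec anyDart? (λ d → anyDarts? (P? ∘ (d ∷_)) n))

    lookup-injective : ∀ {n} {xs : List (Fin n)} → Unique xs →
                       ∀ {i j} → List.lookup xs i ≡ List.lookup xs j → i ≡ j
    lookup-injective (_  ∷ _)  {zero}  {zero}  _  = refl
    lookup-injective (x≢ ∷ _)  {zero}  {suc j} eq =
      contradiction eq (All.lookup x≢ (∈-lookup j))
    lookup-injective (x≢ ∷ _)  {suc i} {zero}  eq =
      contradiction (sym eq) (All.lookup x≢ (∈-lookup i))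
    lookup-injective (_  ∷ xs) {suc i} {suc j} eq = cong suc (lookup-injective xs eq)

    unique-length : ∀ {n} {xs : List (Fin n)} → Unique xs → length xs ℕ.≤ n
    unique-length u = Fin.injective⇒≤ (lookup-injective u)

    bounded : ∀ {n} (f : Dart → Fin n) {ds} → Unique (map f ds) → length ds ℕ.≤ n
    bounded f {ds} u = subst (ℕ._≤ _) (length-map f ds) (unique-length u)

    open DecMembership (Fin._≟_ {nV}) using () renaming (_∈?_ to _∈ₗ?_)

    cut : ∀ {Y ds u v x} → IsWalk u ds v → All (λ d → edge d ∈ Y) ds →
          Unique (map tail ds) → x ∈ₗ map tail ds →
          ∃[ ds′ ] IsWalk x ds′ v × All (λ d → edge d ∈ Y) ds′ × Unique (map tail ds′)
    cut {ds = d ∷ ds} (_ , w) a       u       (here refl) = d ∷ ds , (refl , w) , a , u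
    cut {ds = d ∷ ds} (_ , w) (_ ∷ a) (_ ∷ u) (there x∈)  = cut w a u x∈

    shorten : ∀ {Y ds u v} → IsWalk u ds v → All (λ d → edge d ∈ Y) ds →
              ∃[ ds′ ] IsWalk u ds′ v × All (λ d → edge d ∈ Y) ds′ × Unique (map tail ds′)
    shorten {ds = []}     w          a        = [] , w , [] , []
    shorten {ds = d ∷ ds} (refl , w) (d∈ ∷ a) with shorten w a
    ... | ds′ , w′ , a′ , u′ with tail d ∈ₗ? map tail ds′
    ...   | yes d∈ds′ = cut w′ a′ u′ d∈ds′
    ...   | no  d∉ds′ = d ∷ ds′ , (refl , w′) , d∈ ∷ a′ , All.¬Any⇒All¬ _ d∉ds′ ∷ u′

  isWalk? : ∀ u ds v → Dec (IsWalk u ds v)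
  isWalk? u []       v = u Fin.≟ v
  isWalk? u (d ∷ ds) v = u Fin.≟ tail d ×-dec isWalk? (head d) ds v

  connected? : Decidable Connected
  connected? Y = ℕ.nonZero? nV ×-dec Fin.all? λ u → Fin.all? λ v → map′
    (λ (ds , _ , p) → ds , p)
    (λ (_ , w , a) → let ds , w′ , a′ , u = shorten w a in ds , bounded tail u , w′ , a′)
    (anyDarts? (λ ds → isWalk? u ds v ×-dec All.all? (λ d → edge d ∈? Y) ds) nV)

  isOrientedCycle? : Decidable IsOrientedCycle
  isOrientedCycle? ds = map′
    (λ (n , c , v , e) → mkOrientedCycle n c v e)
    (λ (mkOrientedCycle n c v e) → n , c , v , e)
    (nonEmpty? ds
      ×-dec Fin.any? (λ v → isWalk? v ds v)
      ×-dec DecUnique.unique? Fin._≟_ (map tail ds)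
      ×-dec DecUnique.unique? Fin._≟_ (map edge ds))
    where
    nonEmpty? : Decidable (_≢ [])
    nonEmpty? []      = no λ ≢[] → ≢[] refl
    nonEmpty? (_ ∷ _) = yes λ ()

  private
    _≟ˢ_ : ∀ {n} (X Y : Subset n) → Dec (X ≡ Y)
    _≟ˢ_ = Vec.≡-dec Bool._≟_

  isCycle? : Decidable IsCycle
  isCycle? C = map′
    (λ (ds , _ , p) → ds , p)
    (λ (ds , c , s) → ds , bounded edge (IsOrientedCycle.distinctEdges c) , c , s)
    (anyDarts? (λ ds → isOrientedCycle? ds ×-dec support ds ≟ˢ C) nE)

  isSpanningTree? : Decidable IsSpanningTree
  isSpanningTree? Y = connected? Y ×-dec
    ¬? (anySubset? (λ C → C ⊆? Y ×-dec isCycle? C))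

  isCycletree? : Decidable IsCycletree
  isCycletree? Y = connected? Y ×-dec anySubset? (λ C → cycleIn? C ×-dec only? C)
    where
    CycleIn : Pred (Subset nE) 0ℓ
    CycleIn C = C ⊆ Y × IsCycle C

    cycleIn? : Decidable CycleIn
    cycleIn? C = C ⊆? Y ×-dec isCycle? C

    only? : ∀ C → Dec (∀ {D} → CycleIn D → C ≡ D)
    only? C = map′
      (λ none {D} p → decidable-stable (C ≟ˢ D) (λ C≢D → none (D , p , C≢D)))
      (λ only (D , p , C≢D) → C≢D (only p))
      (¬? (anySubset? (λ D → cycleIn? D ×-dec ¬? (C ≟ˢ D))))

  allSubsets : ∀ n → List (Subset n)
  allSubsets zero    = Vec.[] ∷ []
  allSubsets (suc n) =
    map (outside Vec.∷_) (allSubsets n) ++ map (inside Vec.∷_) (allSubsets n)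

  spanningTreeCount : ℕ
  spanningTreeCount = length (filter isSpanningTree? (allSubsets nE))

  cycletrees : List Cycletree
  cycletrees = mapMaybe (λ Y → mapᵐ (Y ,_) (dec⇒maybe (isCycletree? Y))) (allSubsets nE)

  ∑-δ : ∀ {n} (f : Vector ℤ n) i → ∑[ j < n ] (f j * δ i j) ≡ f i
  ∑-δ {suc n} f zero    = begin
    f zero * 1ℤ + ∑[ j < n ] (f (suc j) * 0ℤ)
      ≡⟨ cong₂ _+_ (ℤ.*-identityʳ (f zero)) (sum-cong-≗ (λ j → ℤ.*-zeroʳ (f (suc j)))) ⟩
    f zero + ∑[ j < n ] 0ℤ
      ≡⟨ cong (f zero +_) (sum-replicate-zero n) ⟩
    f zero + 0ℤ
      ≡⟨ ℤ.+-identityʳ _ ⟩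
    f zero ∎
  ∑-δ {suc n} f (suc i) = begin
    f zero * 0ℤ + ∑[ j < n ] (f (suc j) * δ i j)
      ≡⟨ cong₂ _+_ (ℤ.*-zeroʳ (f zero)) (∑-δ (f ∘ suc) i) ⟩
    0ℤ + f (suc i)
      ≡⟨ ℤ.+-identityˡ _ ⟩
    f (suc i) ∎

  ∂₁-dart : ∀ e s v → (s ◃ 1) * ∂₁ v e ≡ δ (head (e , s)) v - δ (tail (e , s)) v
  ∂₁-dart e Sign.+ v = ℤ.*-identityˡ _
  ∂₁-dart e Sign.- v = lemma (δ (tgt e) v) (δ (src e) v)
    where
    lemma : ∀ x y → -1ℤ * (x - y) ≡ y - x
    lemma = solve-∀

  ∂₁-walk : ∀ {u v} ds → IsWalk u ds v → ∀ x → (∂₁ · walkChain ds) x ≡ δ v x - δ u x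
  ∂₁-walk {u} [] refl x = begin
    ∑[ e < nE ] (∂₁ x e * 0ℤ)  ≡⟨ sum-cong-≗ (λ e → ℤ.*-zeroʳ (∂₁ x e)) ⟩
    ∑[ e < nE ] 0ℤ             ≡⟨ sum-replicate-zero nE ⟩
    0ℤ                         ≡⟨ ℤ.+-inverseʳ (δ u x) ⟨
    δ u x - δ u x              ∎
  ∂₁-walk {v = v} ((e , s) ∷ ds) (refl , w) x = begin
    ∑[ e′ < nE ] (∂₁ x e′ * ((s ◃ 1) * δ e e′ + walkChain ds e′))
      ≡⟨ sum-cong-≗ (λ e′ → distrib (∂₁ x e′) (s ◃ 1) (δ e e′) (walkChain ds e′)) ⟩
    ∑[ e′ < nE ] ((s ◃ 1) * ∂₁ x e′ * δ e e′ + ∂₁ x e′ * walkChain ds e′)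
      ≡⟨ ∑-distrib-+ (λ e′ → (s ◃ 1) * ∂₁ x e′ * δ e e′) (λ e′ → ∂₁ x e′ * walkChain ds e′) ⟩
    ∑[ e′ < nE ] ((s ◃ 1) * ∂₁ x e′ * δ e e′) + (∂₁ · walkChain ds) x
      ≡⟨ cong₂ _+_ (trans (∑-δ (λ e′ → (s ◃ 1) * ∂₁ x e′) e) (∂₁-dart e s x)) (∂₁-walk ds w x) ⟩
    (δ (head (e , s)) x - δ (tail (e , s)) x) + (δ v x - δ (head (e , s)) x)
      ≡⟨ telescope (δ (head (e , s)) x) (δ (tail (e , s)) x) (δ v x) ⟩
    δ v x - δ (tail (e , s)) x ∎
    where
    distrib : ∀ a b c d → a * (b * c + d) ≡ b * a * c + a * d
    distrib = solve-∀

    telescope : ∀ a b c → (a - b) + (c - a) ≡ c - b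
    telescope = solve-∀

  closed⇒∂₁≡0 : ∀ ds → ∃[ v ] IsWalk v ds v → InKernel ∂₁ (walkChain ds)
  closed⇒∂₁≡0 ds (v , w) x = trans (∂₁-walk ds w x) (ℤ.+-inverseʳ (δ v x))

  cycleVector : ∀ {C} → Orientation C → Z₁
  cycleVector (ds , c , _) = walkChain ds , closed⇒∂₁≡0 ds (IsOrientedCycle.closed c)

  module _ {r} {∂ : Matrix nE r} (u : IsUnicyclizer ∂) (β : Basis (suc r))
           (orient : (Y : Cycletree) → Orientation (cycleOf Y)) where

    -- λ_𝒜 = Σ_Y w_𝒜(z_Y) z_Y, for an arbitrary orientation of each cycle C_Y.
    windingChain : Chain
    windingChain e = foldr _+_ 0ℤ (map (λ Y → winding u β (z Y) * proj₁ (z Y) e) cycletrees)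
      where
      z : Cycletree → Z₁
      z Y = cycleVector (orient Y)

{-# OPTIONS --safe #-}
-- Only the ℤ-linearity of w = w_𝒜 matters (det is expanded along its first
-- column), so that the claim is the image under w of the identity
--   Σ_Y (C ∘ z_Y) z_Y = k(G) C.
-- If T is a spanning tree and e ∉ T, then T + e is a cycletree whose cycle
-- contains e; conversely, removing an edge e of C_Y from a cycletree Y leaves
-- a spanning tree. Each spanning tree T expands C in its fundamental cycles,
--   C = Σ_{e ∉ T} C_e z_{T+e}(e) z_{T+e},
-- because the difference of the two sides is a circulation supported on T:
-- following the positive flow of a nonzero circulation backwards closes up to
-- a cycle in its support, and T has none. Summing over T and reindexing the
-- pairs (T , e) by (Y , e) = (T + e , e) gives the identity.
module Submission where

import Algebra.Properties.Semiring.Sum as Sum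
open import Data.Bool.Base using (if_then_else_)
open import Data.Fin.Base using (Fin; zero; suc; toℕ; punchIn)
import Data.Fin.Properties as Fin
open import Data.Fin.Subset using (Subset; inside; outside; ⊤; _∈_; _∉_; _⊆_; ⁅_⁆)
open import Data.Fin.Subset.Properties
  using (_∈?_; x∈⁅x⁆; x∈⁅y⁆⇒x≡y; x∈p∪q⁻; x∈p∪q⁺; ∉⊥; ⊆-antisym)
open import Data.Integer.Base
  using (ℤ; 0ℤ; 1ℤ; -1ℤ; +_; -_; _+_; _-_; _*_; _^_; _◃_; _<_; _≤_)
import Data.Integer.Properties as ℤ
open import Data.Integer.Tactic.RingSolver using (solve-∀)
open import Data.List.Base as List using (List; []; _∷_; _++_; map; foldr; filter; length; mapMaybe)
import Data.List.Membership.DecPropositional as DecMembership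
open import Data.List.Membership.Propositional using () renaming (_∈_ to _∈ₗ_; _∉_ to _∉ₗ_)
open import Data.List.Membership.Propositional.Properties using (∈-lookup; ∈-map⁺)
open import Data.List.Properties using (map-∘; map-cong; length-map)
open import Data.List.Relation.Unary.All as All using (All; []; _∷_)
import Data.List.Relation.Unary.All.Properties as All
open import Data.List.Relation.Unary.AllPairs using ([]; _∷_)
open import Data.List.Relation.Unary.Any using (here; there)
open import Data.List.Relation.Unary.Unique.Propositional using (Unique)
open import Data.List.Relation.Unary.Unique.Propositional.Properties using (Unique[x∷xs]⇒x∉xs)
open import Data.Maybe.Base as Maybe using (Maybe; just; nothing; maybe′)
open import Data.Nat.Base as ℕ using (ℕ; zero; suc)
import Data.Nat.Properties as ℕ
open import Data.Product.Base using (∃-syntax; _×_; _,_; proj₁; proj₂)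
open import Data.Sign.Base as Sign using (Sign)
open import Data.Sum.Base using (inj₁; inj₂)
open import Data.Vec.Base as Vec using (_[_]≔_)
open import Data.Vec.Functional using (Vector)
open import Data.Vec.Properties
  using ([]≔-updates; []≔-minimal; lookup⇒[]=; []=⇒lookup; lookup∘update′)
open import Defs
open import Function.Base using (_∘_)
open import Relation.Binary.Definitions using (tri<; tri≈; tri>)
open import Relation.Binary.PropositionalEquality
open import Relation.Nullary using (¬_; Dec; yes; no; does; contradiction)
open import Relation.Nullary.Decidable
  using (_×-dec_; _⊎-dec_; map′; dec-true; dec-false; dec⇒maybe)
open import Relation.Unary using (Decidable)

open Sum ℤ.+-*-semiring
  using (sum-cong-≗; sum-replicate-zero; ∑-distrib-+; ∑-comm; *-distribˡ-sum; *-distribʳ-sum)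
open ≡-Reasoning

-- Finite sums, integer matrices and their kernels.

∑-distrib-minus : ∀ {n} (f g : Vector ℤ n) → ∑[ i < n ] (f i - g i) ≡ sum f - sum g
∑-distrib-minus {n} f g = begin
  ∑[ i < n ] (f i - g i)              ≡⟨ ∑-distrib-+ f (λ i → - g i) ⟩
  sum f + ∑[ i < n ] (- g i)          ≡⟨ cong (_+_ (sum f)) (sum-cong-≗ (λ i → ℤ.-1*i≡-i (g i))) ⟨
  sum f + ∑[ i < n ] (-1ℤ * g i)      ≡⟨ cong (_+_ (sum f)) (*-distribˡ-sum -1ℤ g) ⟨
  sum f + -1ℤ * sum g                 ≡⟨ cong (_+_ (sum f)) (ℤ.-1*i≡-i (sum g)) ⟩
  sum f - sum g                       ∎

·-distrib-minus : ∀ {m n} (M : Matrix m n) x y →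
                  M · (λ j → x j - y j) ≗ λ i → (M · x) i - (M · y) i
·-distrib-minus M x y i = trans
  (sum-cong-≗ (λ j → distrib (M i j) (x j) (y j)))
  (∑-distrib-minus (λ j → M i j * x j) (λ j → M i j * y j))
  where
  distrib : ∀ a b c → a * (b - c) ≡ a * b - a * c
  distrib = solve-∀

·-combination : ∀ {m n k} (M : Matrix m n) (v : Vector (Vector ℤ n) k) c →
                M · (ofColumns v · c) ≗ ofColumns (λ j → M · v j) · c
·-combination {n = n} {k} M v c i = begin
  ∑[ l < n ] (M i l * ∑[ j < k ] (v j l * c j))
    ≡⟨ sum-cong-≗ (λ l → *-distribˡ-sum (M i l) (λ j → v j l * c j)) ⟩
  ∑[ l < n ] ∑[ j < k ] (M i l * (v j l * c j))
    ≡⟨ ∑-comm (λ l j → M i l * (v j l * c j)) ⟩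
  ∑[ j < k ] ∑[ l < n ] (M i l * (v j l * c j))
    ≡⟨ sum-cong-≗ (λ j → sum-cong-≗ (λ l → ℤ.*-assoc (M i l) (v j l) (c j))) ⟨
  ∑[ j < k ] ∑[ l < n ] (M i l * v j l * c j)
    ≡⟨ sum-cong-≗ (λ j → *-distribʳ-sum (c j) (λ l → M i l * v j l)) ⟨
  ∑[ j < k ] ((M · v j) i * c j) ∎

ker-minus : ∀ {m n} (M : Matrix m n) {x y} →
            InKernel M x → InKernel M y → InKernel M (λ j → x j - y j)
ker-minus M {x} {y} x∈ y∈ i = begin
  (M · (λ j → x j - y j)) i  ≡⟨ ·-distrib-minus M x y i ⟩
  (M · x) i - (M · y) i      ≡⟨ cong₂ _-_ (x∈ i) (y∈ i) ⟩
  0ℤ                         ∎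

ker-combination : ∀ {m n k} (M : Matrix m n) {v : Vector (Vector ℤ n) k} →
                  (∀ j → InKernel M (v j)) → ∀ c → InKernel M (ofColumns v · c)
ker-combination {k = k} M {v} v∈ c i = begin
  (M · (ofColumns v · c)) i         ≡⟨ ·-combination M v c i ⟩
  ∑[ j < k ] ((M · v j) i * c j)    ≡⟨ sum-cong-≗ (λ j → cong (_* c j) (v∈ j i)) ⟩
  ∑[ j < k ] 0ℤ                     ≡⟨ sum-replicate-zero k ⟩
  0ℤ                                ∎

ker-scale : ∀ {m n} (M : Matrix m n) {x} → InKernel M x → ∀ a → InKernel M (λ j → x j * a)
ker-scale {n = n} M {x} x∈ a i = begin
  ∑[ j < n ] (M i j * (x j * a))  ≡⟨ sum-cong-≗ (λ j → ℤ.*-assoc (M i j) (x j) a) ⟨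
  ∑[ j < n ] (M i j * x j * a)    ≡⟨ *-distribʳ-sum a (λ j → M i j * x j) ⟨
  (M · x) i * a                   ≡⟨ cong (_* a) (x∈ i) ⟩
  0ℤ                              ∎

-- Sums over lists and over all edge subsets.

∑ₗ : ∀ {A : Set} → (A → ℤ) → List A → ℤ
∑ₗ f xs = foldr _+_ 0ℤ (map f xs)

module _ {A : Set} where

  ∑ₗ-cong : ∀ {f g : A → ℤ} → f ≗ g → ∑ₗ f ≗ ∑ₗ g
  ∑ₗ-cong f≗g xs = cong (foldr _+_ 0ℤ) (map-cong f≗g xs)

  ∑ₗ-zero : ∀ {f : A → ℤ} → (∀ x → f x ≡ 0ℤ) → ∀ xs → ∑ₗ f xs ≡ 0ℤ
  ∑ₗ-zero f≡0 []       = refl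
  ∑ₗ-zero f≡0 (x ∷ xs) = cong₂ _+_ (f≡0 x) (∑ₗ-zero f≡0 xs)

  ∑ₗ-++ : ∀ (f : A → ℤ) xs ys → ∑ₗ f (xs ++ ys) ≡ ∑ₗ f xs + ∑ₗ f ys
  ∑ₗ-++ f []       ys = sym (ℤ.+-identityˡ _)
  ∑ₗ-++ f (x ∷ xs) ys = trans (cong (_+_ (f x)) (∑ₗ-++ f xs ys)) (sym (ℤ.+-assoc (f x) _ _))

  *-distribˡ-∑ₗ : ∀ a (f : A → ℤ) xs → a * ∑ₗ f xs ≡ ∑ₗ (λ x → a * f x) xs
  *-distribˡ-∑ₗ a f []       = ℤ.*-zeroʳ a
  *-distribˡ-∑ₗ a f (x ∷ xs) =
    trans (ℤ.*-distribˡ-+ a (f x) _) (cong (_+_ (a * f x)) (*-distribˡ-∑ₗ a f xs))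

  ∑-∑ₗ-comm : ∀ {n} (f : Fin n → A → ℤ) xs →
              ∑[ i < n ] ∑ₗ (f i) xs ≡ ∑ₗ (λ x → ∑[ i < n ] f i x) xs
  ∑-∑ₗ-comm {n} f []       = sum-replicate-zero n
  ∑-∑ₗ-comm {n} f (x ∷ xs) = trans
    (∑-distrib-+ (λ i → f i x) (λ i → ∑ₗ (f i) xs))
    (cong (_+_ (∑[ i < n ] f i x)) (∑-∑ₗ-comm f xs))

  ∑ₗ-mapMaybe : ∀ {B : Set} (f : B → ℤ) (p : A → Maybe B) xs →
                ∑ₗ f (mapMaybe p xs) ≡ ∑ₗ (maybe′ f 0ℤ ∘ p) xs
  ∑ₗ-mapMaybe f p []       = refl
  ∑ₗ-mapMaybe f p (x ∷ xs) with p x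
  ... | just y  = cong (_+_ (f y)) (∑ₗ-mapMaybe f p xs)
  ... | nothing = trans (∑ₗ-mapMaybe f p xs) (sym (ℤ.+-identityˡ _))

  length-filter : ∀ {P : A → Set} (P? : Decidable P) xs →
                  + length (filter P? xs) ≡ ∑ₗ (λ x → if does (P? x) then 1ℤ else 0ℤ) xs
  length-filter P? []       = refl
  length-filter P? (x ∷ xs) with P? x
  ... | yes _ = cong (_+_ 1ℤ) (length-filter P? xs)
  ... | no  _ = trans (length-filter P? xs) (sym (ℤ.+-identityˡ _))

-- Inserting `e` is a bijection from the sets avoiding `e` onto those containing it, and the
-- remaining sets contribute zero on both sides. Induction on the position of `e`, since
-- `allSubsets` splits by the first coordinate.
∑-allSubsets-insert : ∀ (G : Graph) {n} e (f : Subset n → ℤ) → (∀ {Y} → e ∉ Y → f Y ≡ 0ℤ) →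
  ∑ₗ f (allSubsets G n) ≡
  ∑ₗ (λ T → if does (e ∈? T) then 0ℤ else f (T [ e ]≔ inside)) (allSubsets G n)
∑-allSubsets-insert G {suc n} e f f≡0 = begin
  ∑ₗ f (allSubsets G (suc n))
    ≡⟨ split f ⟩
  ∑ₗ (f ∘ (outside Vec.∷_)) (allSubsets G n) + ∑ₗ (f ∘ (inside Vec.∷_)) (allSubsets G n)
    ≡⟨ step e f≡0 ⟩
  ∑ₗ (g e ∘ (outside Vec.∷_)) (allSubsets G n) + ∑ₗ (g e ∘ (inside Vec.∷_)) (allSubsets G n)
    ≡⟨ split (g e) ⟨
  ∑ₗ (g e) (allSubsets G (suc n)) ∎
  where
  g : Fin (suc n) → Subset (suc n) → ℤ
  g e T = if does (e ∈? T) then 0ℤ else f (T [ e ]≔ inside)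

  split : ∀ h → ∑ₗ h (allSubsets G (suc n)) ≡
    ∑ₗ (h ∘ (outside Vec.∷_)) (allSubsets G n) + ∑ₗ (h ∘ (inside Vec.∷_)) (allSubsets G n)
  split h = trans (∑ₗ-++ h (map (outside Vec.∷_) (allSubsets G n)) _)
    (cong₂ (λ xs ys → foldr _+_ 0ℤ xs + foldr _+_ 0ℤ ys)
      (sym (map-∘ (allSubsets G n))) (sym (map-∘ (allSubsets G n))))

  step : ∀ e → (∀ {Y} → e ∉ Y → f Y ≡ 0ℤ) →
    ∑ₗ (f ∘ (outside Vec.∷_)) (allSubsets G n) + ∑ₗ (f ∘ (inside Vec.∷_)) (allSubsets G n) ≡
    ∑ₗ (g e ∘ (outside Vec.∷_)) (allSubsets G n) + ∑ₗ (g e ∘ (inside Vec.∷_)) (allSubsets G n)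
  -- The outside half of `f` vanishes, and so does the inside half of `g zero`. What remains is the
  -- inside half of `f`, which `g zero` reads off the outside sets.
  step zero    f≡0 = begin
    ∑ₗ (f ∘ (outside Vec.∷_)) (allSubsets G n) + S
      ≡⟨ cong (λ x → x + S) (∑ₗ-zero (λ Y → f≡0 λ ()) (allSubsets G n)) ⟩
    0ℤ + S
      ≡⟨ ℤ.+-comm 0ℤ S ⟩
    S + 0ℤ
      ≡⟨ cong (_+_ S) (∑ₗ-zero (λ _ → refl) (allSubsets G n)) ⟨
    S + ∑ₗ (λ _ → 0ℤ) (allSubsets G n) ∎
    where S = ∑ₗ (f ∘ (inside Vec.∷_)) (allSubsets G n)
  step (suc e) f≡0 = cong₂ _+_
    (∑-allSubsets-insert G e (f ∘ (outside Vec.∷_)) (λ e∉ → f≡0 λ { (Vec.there e∈) → e∉ e∈ }))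
    (∑-allSubsets-insert G e (f ∘ (inside Vec.∷_)) (λ e∉ → f≡0 λ { (Vec.there e∈) → e∉ e∈ }))

-- Signs of sums, Kronecker deltas, repetition-free lists, inserted edges.

sum-nonpositive : ∀ {n} (t : Vector ℤ n) → (∀ i → t i ≤ 0ℤ) → sum t ≤ 0ℤ
sum-nonpositive {zero}  t t≤0 = ℤ.≤-refl
sum-nonpositive {suc n} t t≤0 = ℤ.+-mono-≤ (t≤0 zero) (sum-nonpositive (t ∘ suc) (t≤0 ∘ suc))

sum-negative : ∀ {n} (t : Vector ℤ n) → (∀ i → t i ≤ 0ℤ) → ∀ i → t i < 0ℤ → sum t < 0ℤ
sum-negative {suc n} t t≤0 zero    ti<0 = ℤ.+-mono-<-≤ ti<0 (sum-nonpositive (t ∘ suc) (t≤0 ∘ suc))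
sum-negative {suc n} t t≤0 (suc i) ti<0 = ℤ.+-mono-≤-< (t≤0 zero) (sum-negative (t ∘ suc) (t≤0 ∘ suc) i ti<0)

δ-≡ : ∀ {n} (i : Fin n) → δ i i ≡ 1ℤ
δ-≡ i = cong (if_then 1ℤ else 0ℤ) (dec-true (i Fin.≟ i) refl)

δ-≢ : ∀ {n} {i j : Fin n} → i ≢ j → δ i j ≡ 0ℤ
δ-≢ {i = i} {j} i≢j = cong (if_then 1ℤ else 0ℤ) (dec-false (i Fin.≟ j) i≢j)

lookup-injective : ∀ {A : Set} {xs : List A} → Unique xs →
                   ∀ {i j} → List.lookup xs i ≡ List.lookup xs j → i ≡ j
lookup-injective (_ ∷ _)  {zero}  {zero}  eq = refl
lookup-injective (x≢ ∷ u) {zero}  {suc j} eq = contradiction eq (All.lookup x≢ (∈-lookup j))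
lookup-injective (x≢ ∷ u) {suc i} {zero}  eq = contradiction (sym eq) (All.lookup x≢ (∈-lookup i))
lookup-injective (x≢ ∷ u) {suc i} {suc j} eq = cong suc (lookup-injective u eq)

unique-length : ∀ {n} {xs : List (Fin n)} → Unique xs → length xs ℕ.≤ n
unique-length u = Fin.injective⇒≤ (lookup-injective u)

module _ {n} (T : Subset n) (e : Fin n) where

  ∈-insert : e ∈ T [ e ]≔ inside
  ∈-insert = []≔-updates T e

  ⊆-insert : T ⊆ T [ e ]≔ inside
  ⊆-insert {f} f∈T with f Fin.≟ e
  ... | yes refl = ∈-insert
  ... | no  f≢e  = []≔-minimal T f e f≢e f∈T

  ∈-insert⁻ : ∀ {f} → f ∈ T [ e ]≔ inside → f ≢ e → f ∈ T
  ∈-insert⁻ {f} f∈ f≢e = lookup⇒[]= f T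
    (trans (sym (lookup∘update′ f≢e T inside)) ([]=⇒lookup f∈))

-- Linearity of the winding number on the circulations of a graph.

module _ (G : Graph) where
  open Graph G
  open DecMembership (Fin._≟_ {nV}) using () renaming (_∈?_ to _∈ₗ?_)

  -- The combination has to agree with `x` only pointwise as a chain, so linearity also says that
  -- `w` does not see the kernel proof paired with a chain.
  IsLinear : (Z₁ G → ℤ) → Set
  IsLinear w = ∀ {n} (z : Vector (Z₁ G) n) c x →
    ofColumns (proj₁ ∘ z) · c ≗ proj₁ x → w x ≡ (w ∘ z) ∙ c

  -- The basis sends both coefficient vectors to the chain of `x`, so their difference is a relation
  -- among the basis vectors and vanishes by independence.
  coordinates-combination :
    ∀ {m n} (β : Basis G m) (z : Vector (Z₁ G) n) c x → ofColumns (proj₁ ∘ z) · c ≗ proj₁ x →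
    Basis.coordinates β x ≗ ofColumns (Basis.coordinates β ∘ z) · c
  coordinates-combination {m} {n} β z c x zc≗x i =
    ℤ.i-j≡0⇒i≡j _ _ (independent (λ j → coordinates x j - ζc j) vanishes i)
    where
    open Basis β
    B = ofColumns (proj₁ ∘ vectors)
    ζc = ofColumns (coordinates ∘ z) · c

    Bζc≗x : B · ζc ≗ proj₁ x
    Bζc≗x e = begin
      (B · ζc) e                                      ≡⟨ ·-combination B (coordinates ∘ z) c e ⟩
      ∑[ j < n ] ((B · coordinates (z j)) e * c j)    ≡⟨ sum-cong-≗ (λ j → cong (_* c j) (proj₂ (spanning (z j)) e)) ⟩
      ∑[ j < n ] (proj₁ (z j) e * c j)                ≡⟨ zc≗x e ⟩
      proj₁ x e                                       ∎

    vanishes : ∀ e → (B · (λ j → coordinates x j - ζc j)) e ≡ 0ℤ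
    vanishes e = begin
      (B · (λ j → coordinates x j - ζc j)) e    ≡⟨ ·-distrib-minus B (coordinates x) ζc e ⟩
      (B · coordinates x) e - (B · ζc) e        ≡⟨ cong₂ _-_ (proj₂ (spanning x) e) (Bζc≗x e) ⟩
      proj₁ x e - proj₁ x e                     ≡⟨ ℤ.+-inverseʳ (proj₁ x e) ⟩
      0ℤ                                        ∎

  -- The minors along the first column involve only the columns of `∂`, so `winding` pairs a fixed
  -- cofactor vector with the coordinates, which are linear.
  winding-linear : ∀ {r} {∂ : Matrix nE r} (u : IsUnicyclizer G ∂) (β : Basis G (suc r)) →
                   IsLinear (winding G u β)
  winding-linear {r} u β {n} z c x zc≗x = begin
    winding G u β x
      ≡⟨ expand x ⟩
    ∑[ i < suc r ] (cofactor i * coordinates x i)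
      ≡⟨ sum-cong-≗ (λ i → cong (cofactor i *_) (coordinates-combination β z c x zc≗x i)) ⟩
    ∑[ i < suc r ] (cofactor i * (ofColumns (coordinates ∘ z) · c) i)
      -- The cofactor vector is treated as a matrix with a single row.
      ≡⟨ ·-combination {m = 1} (λ _ → cofactor) (coordinates ∘ z) c zero ⟩
    ∑[ j < n ] (∑[ i < suc r ] (cofactor i * coordinates (z j) i) * c j)
      ≡⟨ sum-cong-≗ (λ j → cong (_* c j) (expand (z j))) ⟨
    (winding G u β ∘ z) ∙ c ∎
    where
    open Basis β
    open IsUnicyclizer u

    minor : Fin (suc r) → ℤ
    minor i = det (λ k l → coordinates (columnZ₁ l) (punchIn i k))

    cofactor : Fin (suc r) → ℤ
    cofactor i = -1ℤ ^ toℕ i * minor i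

    swap : ∀ a b c → a * b * c ≡ a * c * b
    swap = solve-∀

    expand : ∀ y → winding G u β y ≡ ∑[ i < suc r ] (cofactor i * coordinates y i)
    expand y = sum-cong-≗ (λ i → swap (-1ℤ ^ toℕ i) (coordinates y i) (minor i))

  -- Supports and chains of walks and cycles.

  ∈-support⁺ : ∀ {ds e} → e ∈ₗ map (edge G) ds → e ∈ support G ds
  ∈-support⁺ {d ∷ ds} (here refl) = x∈p∪q⁺ (inj₁ (x∈⁅x⁆ (edge G d)))
  ∈-support⁺ {d ∷ ds} (there e∈)  = x∈p∪q⁺ (inj₂ (∈-support⁺ e∈))

  ∈-support⁻ : ∀ {ds e} → e ∈ support G ds → e ∈ₗ map (edge G) ds
  ∈-support⁻ {[]}     e∈ = contradiction e∈ ∉⊥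
  ∈-support⁻ {d ∷ ds} e∈ with x∈p∪q⁻ ⁅ edge G d ⁆ (support G ds) e∈
  ... | inj₁ e∈d  = here (x∈⁅y⁆⇒x≡y _ e∈d)
  ... | inj₂ e∈ds = there (∈-support⁻ e∈ds)

  support-⊆ : ∀ {ds Y} → All (λ d → edge G d ∈ Y) ds → support G ds ⊆ Y
  support-⊆ ds⊆Y e∈ = All.lookup (All.map⁺ ds⊆Y) (∈-support⁻ e∈)

  walkChain-∉ : ∀ ds {e} → e ∉ₗ map (edge G) ds → walkChain G ds e ≡ 0ℤ
  walkChain-∉ []             e∉ = refl
  walkChain-∉ ((f , s) ∷ ds) {e} e∉ = begin
    (s ◃ 1) * δ f e + walkChain G ds e
      ≡⟨ cong₂ (λ a b → (s ◃ 1) * a + b) (δ-≢ (λ f≡e → e∉ (here (sym f≡e)))) (walkChain-∉ ds (e∉ ∘ there)) ⟩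
    (s ◃ 1) * 0ℤ + 0ℤ
      ≡⟨ cong (λ a → a + 0ℤ) (ℤ.*-zeroʳ (s ◃ 1)) ⟩
    0ℤ ∎

  walkChain-∷ : ∀ {f} s ds → f ∉ₗ map (edge G) ds → walkChain G ((f , s) ∷ ds) f ≡ s ◃ 1
  walkChain-∷ {f} s ds f∉ = begin
    (s ◃ 1) * δ f f + walkChain G ds f
      ≡⟨ cong₂ (λ a b → (s ◃ 1) * a + b) (δ-≡ f) (walkChain-∉ ds f∉) ⟩
    (s ◃ 1) * 1ℤ + 0ℤ
      ≡⟨ simplify (s ◃ 1) ⟩
    s ◃ 1 ∎
    where
    simplify : ∀ a → a * 1ℤ + 0ℤ ≡ a
    simplify = solve-∀

  ◃1-square : ∀ s → (s ◃ 1) * (s ◃ 1) ≡ 1ℤ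
  ◃1-square Sign.+ = refl
  ◃1-square Sign.- = refl

  -- With distinct edges only one dart contributes at `e`, and it contributes a sign. Squaring
  -- records this for either sign.
  walkChain-∈ : ∀ {ds e} → Unique (map (edge G) ds) → e ∈ₗ map (edge G) ds →
                walkChain G ds e * walkChain G ds e ≡ 1ℤ
  walkChain-∈ {(f , s) ∷ ds} u@(_ ∷ _) (here refl) =
    trans (cong (λ a → a * a) (walkChain-∷ s ds (Unique[x∷xs]⇒x∉xs u))) (◃1-square s)
  walkChain-∈ {(f , s) ∷ ds} {e} u@(_ ∷ v) (there e∈) =
    trans (cong (λ a → a * a) drop-first) (walkChain-∈ v e∈)
    where
    drop-first : (s ◃ 1) * δ f e + walkChain G ds e ≡ walkChain G ds e
    drop-first = begin
      (s ◃ 1) * δ f e + walkChain G ds e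
        ≡⟨ cong (λ a → (s ◃ 1) * a + walkChain G ds e)
             (δ-≢ {i = f} {e} (λ { refl → Unique[x∷xs]⇒x∉xs u e∈ })) ⟩
      (s ◃ 1) * 0ℤ + walkChain G ds e
        ≡⟨ cong (λ a → a + walkChain G ds e) (ℤ.*-zeroʳ (s ◃ 1)) ⟩
      0ℤ + walkChain G ds e
        ≡⟨ ℤ.+-identityˡ _ ⟩
      walkChain G ds e ∎

  cycleVector-∉ : ∀ {C} (o : Orientation G C) {e} → e ∉ C → proj₁ (cycleVector G o) e ≡ 0ℤ
  cycleVector-∉ (ds , _ , refl) e∉ = walkChain-∉ ds (e∉ ∘ ∈-support⁺)

  cycleVector-∈ : ∀ {C} (o : Orientation G C) {e} → e ∈ C →
                  proj₁ (cycleVector G o) e * proj₁ (cycleVector G o) e ≡ 1ℤ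
  cycleVector-∈ (ds , c , refl) e∈ =
    walkChain-∈ (IsOrientedCycle.distinctEdges c) (∈-support⁻ e∈)

  -- Positive flow and cycles in the support of a circulation.

  walk-prefix : ∀ {u v x ds} {P : Dart G → Set} → IsWalk G u ds v → All P ds →
                Unique (map (tail G) ds) → x ∈ₗ map (tail G) ds →
                ∃[ p ] IsWalk G u p x × All P p × Unique (map (tail G) p) × x ∉ₗ map (tail G) p
  walk-prefix {ds = d ∷ ds} (u≡ , w) (Pd ∷ Pds) (_ ∷ uniq) (here refl) =
    [] , u≡ , [] , [] , λ ()
  walk-prefix {ds = d ∷ ds} {P} (u≡ , w) (Pd ∷ Pds) (d≢ ∷ uniq) (there x∈)
    -- The predicate is strengthened to remember that later darts do not start at `tail G d`, so
    -- that the prefix inherits distinct tails.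
    with walk-prefix {P = λ d′ → P d′ × tail G d ≢ tail G d′} w
           (All.zip (Pds , All.map⁻ d≢)) uniq x∈
  ... | p , w′ , Pp , uniq′ , x∉ =
    d ∷ p , (u≡ , w′) , Pd ∷ All.map proj₁ Pp , All.map⁺ (All.map proj₂ Pp) ∷ uniq′ ,
    λ { (here x≡) → All.lookup d≢ x∈ (sym x≡) ; (there x∈p) → x∉ x∈p }

  module _ (x : Z₁ G) where

    flow : Dart G → ℤ
    flow (e , s) = (s ◃ 1) * proj₁ x e

    record Positive (d : Dart G) : Set where
      constructor positive
      field 0<flow : 0ℤ < flow d

    open Positive

    -- The two directions of an edge carry opposite flows, so at most one of them is positive.
    positive-edge : ∀ {d d′} → Positive d → Positive d′ → edge G d ≡ edge G d′ → d ≡ d′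
    positive-edge {e , Sign.+} {_ , Sign.+} _ _ refl = refl
    positive-edge {e , Sign.-} {_ , Sign.-} _ _ refl = refl
    positive-edge {e , Sign.+} {_ , Sign.-} p q refl = contradiction (opposite (0<flow p)) (ℤ.<-asym (0<flow q))
      where
      opposite : 0ℤ < 1ℤ * proj₁ x e → -1ℤ * proj₁ x e < 0ℤ
      opposite p = subst₂ _<_ (sym (ℤ.-1*i≡-i _)) refl
        (ℤ.neg-mono-< (subst (0ℤ <_) (ℤ.*-identityˡ (proj₁ x e)) p))
    positive-edge {e , Sign.-} {_ , Sign.+} p q refl = sym (positive-edge q p refl)

    positive⇒≢0 : ∀ {d} → Positive d → proj₁ x (edge G d) ≢ 0ℤ
    positive⇒≢0 {e , s} (positive p) x≡0 =
      ℤ.<-irrefl (sym (trans (cong ((s ◃ 1) *_) x≡0) (ℤ.*-zeroʳ (s ◃ 1)))) p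

    ≢0⇒positive : ∀ {e} → proj₁ x e ≢ 0ℤ → ∃[ s ] Positive (e , s)
    ≢0⇒positive {e} x≢0 with ℤ.<-cmp 0ℤ (proj₁ x e)
    ... | tri< 0<x _ _ = Sign.+ , positive (subst (0ℤ <_) (sym (ℤ.*-identityˡ _)) 0<x)
    ... | tri≈ _ 0≡x _ = contradiction (sym 0≡x) x≢0
    ... | tri> _ _ x<0 = Sign.- , positive (subst (0ℤ <_) (sym (ℤ.-1*i≡-i _)) (ℤ.neg-mono-< x<0))

    δ*-nonpositive : ∀ {n} {i j : Fin n} {a} → (i ≡ j → a ≤ 0ℤ) → δ i j * a ≤ 0ℤ
    δ*-nonpositive {i = i} {j} {a} h with i Fin.≟ j
    ... | yes i≡j = subst (_≤ 0ℤ) (sym (ℤ.*-identityˡ a)) (h i≡j)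
    ... | no  _   = ℤ.≤-refl

    -- Splits the boundary term of an edge at `v` into the flows of its two darts into `v`, so that
    -- a bound on inflow bounds the term.
    net-flow : ∀ e v → ∂₁ G v e * proj₁ x e ≡
               δ (tgt e) v * flow (e , Sign.+) + δ (src e) v * flow (e , Sign.-)
    net-flow e v = lemma (δ (tgt e) v) (δ (src e) v) (proj₁ x e)
      where
      lemma : ∀ a b c → (a - b) * c ≡ a * (1ℤ * c) + b * (-1ℤ * c)
      lemma = solve-∀

    -- Conservation at `tail G d`: if no positive dart entered this vertex, every edge would
    -- contribute at most zero to the boundary there and the edge of `d` strictly less, while the
    -- total is zero.
    incoming : ∀ {d} → Positive d → ∃[ d′ ] head G d′ ≡ tail G d × Positive d′
    incoming {d} d>0 with Fin.any? (λ e → into? (e , Sign.+) ⊎-dec into? (e , Sign.-))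
      where
      into? : ∀ d′ → Dec (head G d′ ≡ tail G d × Positive d′)
      into? d′ = head G d′ Fin.≟ tail G d ×-dec map′ positive 0<flow (0ℤ ℤ.<? flow d′)
    ... | yes (e , inj₁ p) = (e , Sign.+) , p
    ... | yes (e , inj₂ p) = (e , Sign.-) , p
    ... | no  none = contradiction (sum-negative t t≤0 (edge G d) t<0) (ℤ.<-irrefl (proj₂ x v))
      where
      v = tail G d
      t : Vector ℤ nE
      t e = ∂₁ G v e * proj₁ x e

      into≤0 : ∀ d′ → head G d′ ≡ v → flow d′ ≤ 0ℤ
      into≤0 (e , Sign.+) h = ℤ.≮⇒≥ λ p → none (e , inj₁ (h , positive p))
      into≤0 (e , Sign.-) h = ℤ.≮⇒≥ λ p → none (e , inj₂ (h , positive p))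

      t≤0 : ∀ e → t e ≤ 0ℤ
      t≤0 e = subst (_≤ 0ℤ) (sym (net-flow e v))
        (ℤ.+-mono-≤ (δ*-nonpositive (into≤0 (e , Sign.+))) (δ*-nonpositive (into≤0 (e , Sign.-))))

      t≡ : ∀ e s → t e ≡ δ (head G (e , s)) v * flow (e , s) - δ (tail G (e , s)) v * flow (e , s)
      t≡ e Sign.+ = lemma (δ (tgt e) v) (δ (src e) v) (proj₁ x e)
        where
        lemma : ∀ a b c → (a - b) * c ≡ a * (1ℤ * c) - b * (1ℤ * c)
        lemma = solve-∀
      t≡ e Sign.- = lemma (δ (tgt e) v) (δ (src e) v) (proj₁ x e)
        where
        lemma : ∀ a b c → (a - b) * c ≡ b * (-1ℤ * c) - a * (-1ℤ * c)
        lemma = solve-∀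

      t<0 : t (edge G d) < 0ℤ
      -- The outflow along `d` makes the term negative. The head part matters only for a loop, where
      -- `d` itself enters `v` and `into≤0` applies to it.
      t<0 = subst (_< 0ℤ) (sym (t≡ (edge G d) (proj₂ d)))
        (ℤ.+-mono-≤-< (δ*-nonpositive (into≤0 d)) (ℤ.neg-mono-<
          (subst (0ℤ <_) (sym (trans (cong (_* flow d) (δ-≡ v)) (ℤ.*-identityˡ (flow d)))) (0<flow d>0))))

    -- A repeated edge would be traversed in the same direction, by positivity, hence from the same
    -- tail. This rules out going back and forth along one edge.
    distinct-edges : ∀ {ds} → All Positive ds → Unique (map (tail G) ds) → Unique (map (edge G) ds)
    distinct-edges []         []        = []
    distinct-edges (d>0 ∷ ds>0) (d≢ ∷ u) =
      All.map⁺ (All.zipWith (λ (d′>0 , t≢) e≡ → t≢ (cong (tail G) (positive-edge d>0 d′>0 e≡)))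
        (ds>0 , All.map⁻ d≢))
      ∷ distinct-edges ds>0 u

    -- Extending a positive walk backwards must eventually revisit a vertex.
    extend : ∀ k d ds {v} → IsWalk G (head G d) ds v → All Positive (d ∷ ds) →
             Unique (map (tail G) (d ∷ ds)) → nV ℕ.≤ k ℕ.+ length ds →
             ∃[ ds′ ] IsOrientedCycle G ds′ × All Positive ds′
    -- `k` is fuel: the bound `nV ≤ k + length ds` is kept throughout, so at `k = 0` the walk would
    -- have `1 + length ds > nV` distinct tails.
    extend zero    d ds w pos uniq nV≤ = contradiction (ℕ.≤-trans
      (subst (ℕ._≤ nV) (length-map (tail G) (d ∷ ds)) (unique-length uniq)) nV≤) ℕ.1+n≰n
    extend (suc k) d ds w pos@(d>0 ∷ _) uniq nV≤ with incoming d>0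
    ... | d′ , h , d′>0 with tail G d′ ∈ₗ? map (tail G) (d ∷ ds)
    ...   | no  t∉ = extend k d′ (d ∷ ds) (h , w) (d′>0 ∷ pos)
      (All.¬Any⇒All¬ _ t∉ ∷ uniq) (subst (nV ℕ.≤_) (sym (ℕ.+-suc k (length ds))) nV≤)
    -- Only the part of the walk up to the revisited vertex is kept. `d′` leads from that vertex to
    -- the start of the walk and closes it up.
    ...   | yes t∈ with walk-prefix (h , w) pos uniq t∈
    ...     | p , w′ , p>0 , uniq′ , t∉ =
      d′ ∷ p ,
      mkOrientedCycle (λ ()) (tail G d′ , refl , w′) u (distinct-edges (d′>0 ∷ p>0) u) ,
      d′>0 ∷ p>0
      where
      u : Unique (map (tail G) (d′ ∷ p))
      u = All.¬Any⇒All¬ _ t∉ ∷ uniq′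

    positive-cycle : ∀ {e} → proj₁ x e ≢ 0ℤ → ∃[ ds ] IsOrientedCycle G ds × All Positive ds
    positive-cycle {e} x≢0 =
      let s , p = ≢0⇒positive x≢0 in
      extend nV (e , s) [] refl (p ∷ []) ([] ∷ []) (ℕ.m≤m+n nV 0)

  SupportedOn : Subset nE → Chain G → Set
  SupportedOn Y x = ∀ {e} → e ∉ Y → x e ≡ 0ℤ

  cycle-in-support : ∀ {Y e} (x : Z₁ G) → SupportedOn Y (proj₁ x) → proj₁ x e ≢ 0ℤ →
                     ∃[ C ] C ⊆ Y × IsCycle G C
  cycle-in-support {Y} x x⊆Y x≢0 =
    let ds , c , ds>0 = positive-cycle x x≢0 in
    support G ds , support-⊆ (All.map in-Y ds>0) , ds , c , refl
    where
    in-Y : ∀ {d} → Positive x d → edge G d ∈ Y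
    in-Y {d} d>0 with edge G d ∈? Y
    ... | yes e∈Y = e∈Y
    ... | no  e∉Y = contradiction (x⊆Y e∉Y) (positive⇒≢0 x d>0)

  Acyclic : Subset nE → Set
  Acyclic T = ¬ (∃[ C ] C ⊆ T × IsCycle G C)

  -- The tool for proving circulations equal: if they agree off `T`, their difference lives on `T`,
  -- where a nonzero value would produce a cycle.
  acyclic⇒≡0 : ∀ {T} → Acyclic T → (x : Z₁ G) → SupportedOn T (proj₁ x) → ∀ e → proj₁ x e ≡ 0ℤ
  acyclic⇒≡0 acyclic x x⊆T e with proj₁ x e ℤ.≟ 0ℤ
  ... | yes x≡0 = x≡0
  ... | no  x≢0 = contradiction (cycle-in-support x x⊆T x≢0) acyclic

  -- Walks inside an edge set, and deleting an edge of a cycle.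

  Linked : Subset nE → Fin nV → Fin nV → Set
  Linked Y u v = ∃[ ds ] IsWalk G u ds v × All (λ d → edge G d ∈ Y) ds

  linked-refl : ∀ {Y u} → Linked Y u u
  linked-refl = [] , refl , []

  linked-trans : ∀ {Y u v w} → Linked Y u v → Linked Y v w → Linked Y u w
  linked-trans ([] , refl , []) l = l
  linked-trans (d ∷ ds , (u≡ , w) , d∈ ∷ ds∈) l =
    let ds′ , w′ , ds′∈ = linked-trans (ds , w , ds∈) l in d ∷ ds′ , (u≡ , w′) , d∈ ∷ ds′∈

  linked-dart : ∀ {Y} d → edge G d ∈ Y → Linked Y (tail G d) (head G d)
  linked-dart d d∈ = d ∷ [] , (refl , refl) , d∈ ∷ []

  linked-dart⁻ : ∀ {Y} d → edge G d ∈ Y → Linked Y (head G d) (tail G d)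
  linked-dart⁻ (e , Sign.+) e∈ = linked-dart (e , Sign.-) e∈
  linked-dart⁻ (e , Sign.-) e∈ = linked-dart (e , Sign.+) e∈

  linked-sym : ∀ {Y u v} → Linked Y u v → Linked Y v u
  linked-sym ([] , refl , []) = linked-refl
  linked-sym (d ∷ ds , (refl , w) , d∈ ∷ ds∈) =
    linked-trans (linked-sym (ds , w , ds∈)) (linked-dart⁻ d d∈)

  linked-bind : ∀ {Y T u v} → (∀ d → edge G d ∈ Y → Linked T (tail G d) (head G d)) →
                Linked Y u v → Linked T u v
  linked-bind f ([] , refl , []) = linked-refl
  linked-bind f (d ∷ ds , (refl , w) , d∈ ∷ ds∈) =
    linked-trans (f d d∈) (linked-bind f (ds , w , ds∈))

  linked-mono : ∀ {Y T u v} → Y ⊆ T → Linked Y u v → Linked T u v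
  linked-mono Y⊆T (ds , w , ds∈) = ds , w , All.map Y⊆T ds∈

  -- A walk with distinct edges uses `e` once, so the pieces before and after avoid `e` and stay in
  -- `T`. The sign `s` is the direction in which `e` is passed.
  linked-split : ∀ {T ds u v e} → IsWalk G u ds v → Unique (map (edge G) ds) →
    All (λ d → edge G d ∈ T [ e ]≔ inside) ds → e ∈ₗ map (edge G) ds →
    ∃[ s ] Linked T u (tail G (e , s)) × Linked T (head G (e , s)) v
  linked-split {T} {(e , s) ∷ ds} (refl , w) (e≢ ∷ _) (_ ∷ ds∈) (here refl) =
    s , linked-refl , ds , w ,
    All.zipWith (λ (d∈ , e≢d) → ∈-insert⁻ T e d∈ (e≢d ∘ sym)) (ds∈ , All.map⁻ e≢)
  linked-split {T} {d ∷ ds} {e = e} (refl , w) (d≢ ∷ u) (d∈ ∷ ds∈) (there e∈) =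
    let s , before , after = linked-split w u ds∈ e∈ in
    s , linked-trans (linked-dart d (∈-insert⁻ T e d∈ (All.lookup d≢ e∈))) before , after

  -- As the cycle is closed at `v`, the piece after `e` followed by the piece before it joins the
  -- ends of `e`.
  linked-ends : ∀ {T C e} → IsCycle G C → C ⊆ T [ e ]≔ inside → e ∈ C →
                Linked T (src e) (tgt e)
  linked-ends {T} {C} {e} (ds , c , refl) C⊆ e∈ = ends
    (linked-split (proj₂ closed) distinctEdges
      (All.tabulate (λ d∈ → C⊆ (∈-support⁺ (∈-map⁺ (edge G) d∈)))) (∈-support⁻ e∈))
    where
    open IsOrientedCycle c
    v = proj₁ closed

    ends : ∃[ s ] Linked T v (tail G (e , s)) × Linked T (head G (e , s)) v → Linked T (src e) (tgt e)
    ends (Sign.+ , before , after) = linked-sym (linked-trans after before)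
    ends (Sign.- , before , after) = linked-trans after before

  -- Spanning trees and cycletrees that differ by one edge.

  module _ {T : Subset nE} {e : Fin nE} (e∉T : e ∉ T) where

    private
      Y : Subset nE
      Y = T [ e ]≔ inside

    -- For connectivity, each passage through `e` is replaced by the rest of the cycle. A cycle
    -- inside `T` would be the unique cycle of `Y`, which contains `e`, while `T` does not.
    cycletree⇒tree : (c : IsCycletree G Y) → e ∈ cycleOf G (Y , c) → IsSpanningTree G T
    cycletree⇒tree ((nV≢0 , conn) , C , (C⊆Y , cyc) , only) e∈C =
      (nV≢0 , λ u v → linked-bind dart-linked (conn u v)) ,
      λ (D , D⊆T , D-cyc) → e∉T (D⊆T (subst (e ∈_)
        (only ((λ {f} f∈ → ⊆-insert T e (D⊆T f∈)) , D-cyc)) e∈C))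
      where
      dart-linked : ∀ d → edge G d ∈ Y → Linked T (tail G d) (head G d)
      dart-linked (f , s) f∈Y with f Fin.≟ e
      ... | no  f≢e = linked-dart (f , s) (∈-insert⁻ T e f∈Y f≢e)
      dart-linked (f , Sign.+) f∈Y | yes refl = linked-ends cyc C⊆Y e∈C
      dart-linked (f , Sign.-) f∈Y | yes refl = linked-sym (linked-ends cyc C⊆Y e∈C)

    module _ (tree : IsSpanningTree G T) where

      tree-acyclic = proj₂ tree

      cycle-through : ∀ {C} → C ⊆ Y → IsCycle G C → e ∈ C
      cycle-through {C} C⊆Y cyc with e ∈? C
      ... | yes e∈C = e∈C
      ... | no  e∉C = contradiction
        (C , (λ {f} f∈C → ∈-insert⁻ T e (C⊆Y f∈C) (λ f≡e → e∉C (subst (_∈ C) f≡e f∈C))) , cyc) tree-acyclic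

      -- The cross-multiplied difference cancels at `e`, so it is a circulation supported on the
      -- acyclic `T`.
      proportional : ∀ {C D} → C ⊆ Y → D ⊆ Y → (o : Orientation G C) (p : Orientation G D) → ∀ f →
        let z = proj₁ (cycleVector G o) ; y = proj₁ (cycleVector G p) in
        z f * y e ≡ y f * z e
      proportional C⊆Y D⊆Y o p f = ℤ.i-j≡0⇒i≡j _ _ (acyclic⇒≡0 tree-acyclic
        ( (λ f → z f * y e - y f * z e)
        , ker-minus (∂₁ G) (ker-scale (∂₁ G) (proj₂ (cycleVector G o)) (y e))
            (ker-scale (∂₁ G) (proj₂ (cycleVector G p)) (z e)) )
        supported f)
        where
        z = proj₁ (cycleVector G o)
        y = proj₁ (cycleVector G p)

        supported : SupportedOn T (λ f → z f * y e - y f * z e)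
        supported {f} f∉T with f Fin.≟ e
        ... | yes refl = trans (cong (_- y e * z e) (ℤ.*-comm (z e) (y e))) (ℤ.+-inverseʳ (y e * z e))
        ... | no  f≢e  = cong₂ (λ a b → a * y e - b * z e)
          (cycleVector-∉ o (λ f∈ → f∉T (∈-insert⁻ T e (C⊆Y f∈) f≢e)))
          (cycleVector-∉ p (λ f∈ → f∉T (∈-insert⁻ T e (D⊆Y f∈) f≢e)))

      -- If `f` lay in `C` but not in `D`, proportionality would equate `z f * y e`, a product of
      -- two signs, with zero. Both sides are squared because the signs are unknown.
      cycle-⊆ : ∀ {C D} → C ⊆ Y × IsCycle G C → D ⊆ Y × IsCycle G D → C ⊆ D
      cycle-⊆ {C} {D} (C⊆Y , o) (D⊆Y , p) {f} f∈C with f ∈? D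
      ... | yes f∈D = f∈D
      ... | no  f∉D = contradiction one≡zero λ ()
        where
        z = proj₁ (cycleVector G o)
        y = proj₁ (cycleVector G p)

        square : ∀ a b → (a * b) * (a * b) ≡ (a * a) * (b * b)
        square = solve-∀

        one≡zero : 1ℤ ≡ 0ℤ
        one≡zero = begin
          1ℤ                           ≡⟨ cong₂ _*_ (cycleVector-∈ o f∈C) (cycleVector-∈ p (cycle-through D⊆Y p)) ⟨
          (z f * z f) * (y e * y e)    ≡⟨ square (z f) (y e) ⟨
          (z f * y e) * (z f * y e)    ≡⟨ cong (λ a → a * a) (proportional C⊆Y D⊆Y o p f) ⟩
          (y f * z e) * (y f * z e)    ≡⟨ cong (λ a → (a * z e) * (a * z e)) (cycleVector-∉ p f∉D) ⟩
          0ℤ                           ∎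

      -- Closing `e` by a walk in `T` need not give a cycle, as vertices may repeat. Its chain has
      -- value 1 at `e`, however, so the flow argument extracts a cycle from its support.
      cycle-exists : ∃[ C ] C ⊆ Y × IsCycle G C
      cycle-exists with proj₂ (proj₁ tree) (tgt e) (src e)
      ... | ds , w , ds∈ = cycle-in-support
        (walkChain G loop , closed⇒∂₁≡0 G loop (src e , refl , w))
        (λ f∉Y → walkChain-∉ loop (f∉Y ∘ support-⊆ loop⊆Y ∘ ∈-support⁺ {loop}))
        (λ z≡0 → contradiction (trans (sym z≡0) z≡1) λ ())
        where
        loop = (e , Sign.+) ∷ ds

        loop⊆Y : All (λ d → edge G d ∈ Y) loop
        loop⊆Y = ∈-insert T e ∷ All.map (⊆-insert T e) ds∈

        z≡1 : walkChain G loop e ≡ 1ℤ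
        z≡1 = walkChain-∷ Sign.+ ds (λ e∈ds → e∉T (support-⊆ ds∈ (∈-support⁺ e∈ds)))

      tree⇒cycletree : IsCycletree G Y
      tree⇒cycletree =
        (proj₁ (proj₁ tree) , λ u v → linked-mono {T} (⊆-insert T e) (proj₂ (proj₁ tree) u v)) ,
        let C , C-in = cycle-exists in
        C , C-in , λ {D} D-in → ⊆-antisym {i = C} {D} (cycle-⊆ C-in D-in) (cycle-⊆ D-in C-in)

  -- Expansion in fundamental cycles and summation over spanning trees.

  module _ (z : Subset nE → Z₁ G)
    (z-tree : ∀ {T e} → e ∉ T → IsSpanningTree G T →
      proj₁ (z (T [ e ]≔ inside)) e * proj₁ (z (T [ e ]≔ inside)) e ≡ 1ℤ)
    (z-∉ : ∀ {Y e} → e ∉ Y → proj₁ (z Y) e ≡ 0ℤ)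
    where

    -- When `T` is a spanning tree, the value of the fundamental cycle at `e` is a sign, so
    -- multiplying by it is the same as dividing by it.
    fundamentalCoefficient : Z₁ G → Subset nE → Vector ℤ nE
    fundamentalCoefficient x T e =
      if does (e ∈? T) then 0ℤ else proj₁ x e * proj₁ (z (T [ e ]≔ inside)) e

    -- An edge `g` outside `T` lies in `T [ e ]≔ inside` only for `e = g`, so at `g` only its own
    -- fundamental cycle contributes, and it gives back `proj₁ x g`. The difference is thus a
    -- circulation on `T`.
    fundamental-expansion : ∀ x {T} → IsSpanningTree G T →
      ofColumns (λ e → proj₁ (z (T [ e ]≔ inside))) · fundamentalCoefficient x T ≗ proj₁ x
    fundamental-expansion x {T} tree f = sym (ℤ.i-j≡0⇒i≡j _ _ (acyclic⇒≡0 (proj₂ tree)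
      ( (λ g → proj₁ x g - (ofColumns y · c) g)
      , ker-minus (∂₁ G) (proj₂ x) (ker-combination (∂₁ G) {y} (λ e → proj₂ (z (T [ e ]≔ inside))) c))
      supported f))
      where
      y : Vector (Chain G) nE
      y e = proj₁ (z (T [ e ]≔ inside))

      c : Vector ℤ nE
      c = fundamentalCoefficient x T

      off-tree : ∀ {g} → g ∉ T → ∀ e → y e g * c e ≡ proj₁ x e * δ g e
      off-tree {g} g∉T e with e ∈? T
      ... | yes e∈T = trans (ℤ.*-zeroʳ (y e g)) (sym (trans
        (cong (proj₁ x e *_) (δ-≢ {i = g} {e} (λ { refl → g∉T e∈T }))) (ℤ.*-zeroʳ (proj₁ x e))))
      ... | no  e∉T with g Fin.≟ e
      ...   | yes refl = trans (swap (y e e) (proj₁ x e)) (cong (proj₁ x e *_) (z-tree e∉T tree))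
        where
        swap : ∀ a b → a * (b * a) ≡ b * (a * a)
        swap = solve-∀
      ...   | no  g≢e  = trans
        (cong (_* (proj₁ x e * y e e)) (z-∉ (λ g∈ → g∉T (∈-insert⁻ T e g∈ g≢e))))
        (sym (ℤ.*-zeroʳ (proj₁ x e)))

      supported : SupportedOn T (λ g → proj₁ x g - (ofColumns y · c) g)
      supported {g} g∉T = begin
        proj₁ x g - (ofColumns y · c) g
          ≡⟨ cong (_-_ (proj₁ x g)) (trans (sum-cong-≗ (off-tree g∉T)) (∑-δ G (proj₁ x) g)) ⟩
        proj₁ x g - proj₁ x g
          ≡⟨ ℤ.+-inverseʳ (proj₁ x g) ⟩
        0ℤ ∎

    module _
      (z-nontree : ∀ {T e} → e ∉ T → ¬ IsSpanningTree G T → proj₁ (z (T [ e ]≔ inside)) e ≡ 0ℤ)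
      (w : Z₁ G → ℤ) (w-linear : IsLinear w) (x : Z₁ G)
      where

      pairing : Fin nE → Subset nE → ℤ
      pairing e Y = w (z Y) * proj₁ (z Y) e

      pairing-∉ : ∀ {e Y} → e ∉ Y → pairing e Y ≡ 0ℤ
      pairing-∉ {Y = Y} e∉Y = trans (cong (w (z Y) *_) (z-∉ e∉Y)) (ℤ.*-zeroʳ (w (z Y)))

      extension : Fin nE → Subset nE → ℤ
      extension e T = if does (e ∈? T) then 0ℤ else pairing e (T [ e ]≔ inside)

      -- For a tree this is `w` applied to the fundamental expansion of `x`. For any other `T` each
      -- term vanishes by `z-nontree`.
      ∑-extension : ∀ {T} (tree? : Dec (IsSpanningTree G T)) →
        ∑[ e < nE ] (proj₁ x e * extension e T) ≡ w x * (if does tree? then 1ℤ else 0ℤ)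
      ∑-extension {T} (yes tree) = begin
        ∑[ e < nE ] (proj₁ x e * extension e T)
          ≡⟨ sum-cong-≗ term ⟩
        ∑[ e < nE ] (w (z (T [ e ]≔ inside)) * fundamentalCoefficient x T e)
          ≡⟨ w-linear (λ e → z (T [ e ]≔ inside)) _ x (fundamental-expansion x tree) ⟨
        w x
          ≡⟨ ℤ.*-identityʳ (w x) ⟨
        w x * 1ℤ ∎
        where
        swap : ∀ a b c → a * (b * c) ≡ b * (a * c)
        swap = solve-∀

        term : ∀ e → proj₁ x e * extension e T ≡
                     w (z (T [ e ]≔ inside)) * fundamentalCoefficient x T e
        term e with e ∈? T
        ... | yes _ = trans (ℤ.*-zeroʳ (proj₁ x e)) (sym (ℤ.*-zeroʳ (w (z (T [ e ]≔ inside)))))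
        ... | no  _ = swap (proj₁ x e) (w (z (T [ e ]≔ inside))) (proj₁ (z (T [ e ]≔ inside)) e)
      ∑-extension {T} (no ¬tree) = begin
        ∑[ e < nE ] (proj₁ x e * extension e T)  ≡⟨ sum-cong-≗ term ⟩
        ∑[ e < nE ] 0ℤ                           ≡⟨ sum-replicate-zero nE ⟩
        0ℤ                                       ≡⟨ ℤ.*-zeroʳ (w x) ⟨
        w x * 0ℤ                                 ∎
        where
        term : ∀ e → proj₁ x e * extension e T ≡ 0ℤ
        term e with e ∈? T
        ... | yes _   = ℤ.*-zeroʳ (proj₁ x e)
        ... | no  e∉T = begin
          proj₁ x e * (w y * proj₁ y e)  ≡⟨ cong (λ a → proj₁ x e * (w y * a)) (z-nontree e∉T ¬tree) ⟩
          proj₁ x e * (w y * 0ℤ)         ≡⟨ cong (proj₁ x e *_) (ℤ.*-zeroʳ (w y)) ⟩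
          proj₁ x e * 0ℤ                 ≡⟨ ℤ.*-zeroʳ (proj₁ x e) ⟩
          0ℤ                             ∎
          where y = z (T [ e ]≔ inside)

      ∑-pairing : ∑[ e < nE ] (proj₁ x e * ∑ₗ (pairing e) (allSubsets G nE)) ≡
                  w x * (+ spanningTreeCount G)
      ∑-pairing = begin
        ∑[ e < nE ] (proj₁ x e * ∑ₗ (pairing e) subsets)
          ≡⟨ sum-cong-≗ (λ e → cong (proj₁ x e *_)
               (∑-allSubsets-insert G e (pairing e) pairing-∉)) ⟩
        ∑[ e < nE ] (proj₁ x e * ∑ₗ (extension e) subsets)
          ≡⟨ sum-cong-≗ (λ e → *-distribˡ-∑ₗ (proj₁ x e) (extension e) subsets) ⟩
        ∑[ e < nE ] ∑ₗ (λ T → proj₁ x e * extension e T) subsets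
          ≡⟨ ∑-∑ₗ-comm (λ e T → proj₁ x e * extension e T) subsets ⟩
        ∑ₗ (λ T → ∑[ e < nE ] (proj₁ x e * extension e T)) subsets
          ≡⟨ ∑ₗ-cong (λ T → ∑-extension (isSpanningTree? G T)) subsets ⟩
        ∑ₗ (λ T → w x * treeIndicator T) subsets
          ≡⟨ *-distribˡ-∑ₗ (w x) treeIndicator subsets ⟨
        w x * ∑ₗ treeIndicator subsets
          ≡⟨ cong (w x *_) (length-filter (isSpanningTree? G) subsets) ⟨
        w x * (+ spanningTreeCount G) ∎
        where
        subsets : List (Subset nE)
        subsets = allSubsets G nE

        treeIndicator : Subset nE → ℤ
        treeIndicator T = if does (isSpanningTree? G T) then 1ℤ else 0ℤ

  -- The vectors of the cycletrees and the final identity.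

  module _ (orient : (Y : Cycletree G) → Orientation G (cycleOf G Y)) where

    cycletreeVector : Cycletree G → Z₁ G
    cycletreeVector Y = cycleVector G (orient Y)

    zeroZ₁ : Z₁ G
    zeroZ₁ = walkChain G [] , λ v →
      trans (sum-cong-≗ (λ e → ℤ.*-zeroʳ (∂₁ G v e))) (sum-replicate-zero nE)

    -- z_Y, extended by zero to the edge sets Y that are not cycletrees.
    decVector : ∀ {Y} → Dec (IsCycletree G Y) → Z₁ G
    decVector (yes c) = cycletreeVector (_ , c)
    decVector (no  _) = zeroZ₁

    decVector-∉ : ∀ {Y e} (d : Dec (IsCycletree G Y)) → e ∉ Y → proj₁ (decVector d) e ≡ 0ℤ
    decVector-∉ (yes c@(_ , _ , (C⊆Y , _) , _)) e∉Y = cycleVector-∉ (orient (_ , c)) (e∉Y ∘ C⊆Y)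
    decVector-∉ (no  _) e∉Y = refl

    -- Every cycle in `T [ e ]≔ inside` passes through `e`, since `T` has none.
    decVector-tree : ∀ {T e} (d : Dec (IsCycletree G (T [ e ]≔ inside))) →
      e ∉ T → IsSpanningTree G T → proj₁ (decVector d) e * proj₁ (decVector d) e ≡ 1ℤ
    decVector-tree (yes c@(_ , _ , (C⊆Y , cyc) , _)) e∉T tree =
      cycleVector-∈ (orient (_ , c)) (cycle-through e∉T tree C⊆Y cyc)
    decVector-tree (no ¬c) e∉T tree = contradiction (tree⇒cycletree e∉T tree) ¬c

    -- If `e` lay on the cycle of the cycletree, deleting it would leave a spanning tree.
    decVector-nontree : ∀ {T e} (d : Dec (IsCycletree G (T [ e ]≔ inside))) →
      e ∉ T → ¬ IsSpanningTree G T → proj₁ (decVector d) e ≡ 0ℤ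
    decVector-nontree (yes c) e∉T ¬tree =
      cycleVector-∉ (orient (_ , c)) (¬tree ∘ cycletree⇒tree e∉T c)
    decVector-nontree (no  _) e∉T ¬tree = refl

    -- Both sums read the cycletree proof off the same decision, so `orient` is applied to the same
    -- element in each. An edge set that is not a cycletree adds zero because its vector is zero.
    ∑-cycletrees : ∀ (w : Z₁ G → ℤ) e →
      ∑ₗ (λ Y → w (cycletreeVector Y) * proj₁ (cycletreeVector Y) e) (cycletrees G) ≡
      ∑ₗ (λ Y → w (decVector (isCycletree? G Y)) * proj₁ (decVector (isCycletree? G Y)) e)
         (allSubsets G nE)
    ∑-cycletrees w e = trans
      (∑ₗ-mapMaybe h (λ Y → Maybe.map (Y ,_) (dec⇒maybe (isCycletree? G Y))) (allSubsets G nE))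
      (∑ₗ-cong (λ Y → on-dec (isCycletree? G Y)) (allSubsets G nE))
      where
      h : Cycletree G → ℤ
      h Y = w (cycletreeVector Y) * proj₁ (cycletreeVector Y) e

      on-dec : ∀ {Y} (d : Dec (IsCycletree G Y)) →
               maybe′ h 0ℤ (Maybe.map (Y ,_) (dec⇒maybe d)) ≡ w (decVector d) * proj₁ (decVector d) e
      on-dec (yes c) = refl
      on-dec (no  _) = sym (ℤ.*-zeroʳ (w zeroZ₁))

    ∑-linear-cycletrees : ∀ w → IsLinear w → ∀ x →
      proj₁ x ∙ (λ e → ∑ₗ (λ Y → w (cycletreeVector Y) * proj₁ (cycletreeVector Y) e) (cycletrees G)) ≡
      w x * (+ spanningTreeCount G)
    ∑-linear-cycletrees w w-linear x = trans
      (sum-cong-≗ (λ e → cong (proj₁ x e *_) (∑-cycletrees w e)))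
      (∑-pairing (λ Y → decVector (isCycletree? G Y))
        (λ {T} {e} → decVector-tree (isCycletree? G (T [ e ]≔ inside)))
        (λ {Y} → decVector-∉ (isCycletree? G Y))
        (λ {T} {e} → decVector-nontree (isCycletree? G (T [ e ]≔ inside)))
        w w-linear x)

theorem5p1p1 : (G : Graph) → Connected G ⊤ →
    {r : ℕ} (∂ : Matrix (Graph.nE G) r) (u : IsUnicyclizer G ∂) (β : Basis G (suc r))
    (orient : (Y : Cycletree G) → Orientation G (cycleOf G Y))
    (C : Z₁ G) →
    proj₁ C ∙ windingChain G u β orient ≡ winding G u β C * (+ spanningTreeCount G)
theorem5p1p1 G _ ∂ u β orient C =
  ∑-linear-cycletrees G orient (winding G u β) (winding-linear G u β) C
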